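{- $c(K_3,C_5)=c_{10/17}(K_3,C_5)=3/34$.
   Context: $K_3$ is the triangle and $C_5$ the cycle of length 5. For graphs $H,G$, $t(H,G)=\hom(H,G)/v(G)^{v(H)}$ is the probability that a uniformly random map $V(H)\to V(G)$ is a homomorphism. Let $G_1,G_2,\dots$ be a sequence containing every finite graph exactly once; $\overline{G}$ is the complement of $G$. For $\lambda\in[0,2]$, $c_\lambda(H_1,H_2):=\liminf_{n\to\infty}\left[\lambda\, t(H_1,G_n)+(2-\lambda)\, t(H_2,\overline{G_n})\right]$, and $c(H_1,H_2):=\sup_{\lambda\in[0,2]}c_\lambda(H_1,H_2)$.
   Formalization: In the supremum defining c(K_3,C_5), λ ranges over the rational numbers in [0,2] instead of all real numbers in [0,2]; the real case follows by continuity of c_λ in λ. -}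

module Defs where

open import Data.Bool using (Bool; true; false; not; _∧_; if_then_else_)
open import Data.Nat as ℕ using (ℕ; zero; suc; _^_)
open import Data.Nat.Properties using (m^n≢0)
open import Data.Fin as Fin using (Fin; zero; suc)
open import Data.Integer using (+_)
open import Data.Rational using (ℚ; _/_; _+_; _*_; _-_; 0ℚ; 1ℚ)
open import Relation.Binary.PropositionalEquality using (_≡_)
open import Relation.Nullary.Decidable using (⌊_⌋)

record Graph (n : ℕ) : Set where
  field
    adj    : Fin n → Fin n → Bool
    sym    : ∀ i j → adj i j ≡ adj j i
    irrefl : ∀ i → adj i i ≡ false
open Graph public

compl : ∀ {n} → Graph n → Fin n → Fin n → Bool
compl G i j = not (adj G i j) ∧ not ⌊ i Fin.≟ j ⌋

sumFin : (n : ℕ) → (Fin n → ℕ) → ℕ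
sumFin zero    f = 0
sumFin (suc n) f = f zero ℕ.+ sumFin n (λ i → f (suc i))

allFin : (n : ℕ) → (Fin n → Bool) → Bool
allFin zero    f = true
allFin (suc n) f = f zero ∧ allFin n (λ i → f (suc i))

countMaps : (k n : ℕ) → ((Fin k → Fin n) → Bool) → ℕ
countMaps zero    n P = if P (λ ()) then 1 else 0
countMaps (suc k) n P =
  sumFin n (λ v → countMaps k n (λ f → P (λ { zero → v ; (suc i) → f i })))

isHom : ∀ {k n} → Graph k → (Fin n → Fin n → Bool) → (Fin k → Fin n) → Bool
isHom {k} H A f = allFin k (λ i → allFin k (λ j →
  if adj H i j then A (f i) (f j) else true))

hom : ∀ {k n} → Graph k → (Fin n → Fin n → Bool) → ℕ
hom {k} {n} H A = countMaps k n (isHom H A)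

tdens : ∀ {k m} → Graph k → (Fin (suc m) → Fin (suc m) → Bool) → ℚ
tdens {k} {m} H A = (+ hom H A) / (suc m ^ k)
  where instance _ = m^n≢0 (suc m) k

t : ∀ {k m} → Graph k → Graph (suc m) → ℚ
t H G = tdens H (adj G)

tc : ∀ {k m} → Graph k → Graph (suc m) → ℚ
tc H G = tdens H (compl G)

K3 : Graph 3
K3 = record { adj = λ i j → not ⌊ i Fin.≟ j ⌋ ; sym = s ; irrefl = r }
  where
  s : ∀ (i j : Fin 3) → not ⌊ i Fin.≟ j ⌋ ≡ not ⌊ j Fin.≟ i ⌋
  s zero zero = _≡_.refl
  s zero (suc zero) = _≡_.refl
  s zero (suc (suc zero)) = _≡_.refl
  s (suc zero) zero = _≡_.refl
  s (suc zero) (suc zero) = _≡_.refl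
  s (suc zero) (suc (suc zero)) = _≡_.refl
  s (suc (suc zero)) zero = _≡_.refl
  s (suc (suc zero)) (suc zero) = _≡_.refl
  s (suc (suc zero)) (suc (suc zero)) = _≡_.refl
  r : ∀ (i : Fin 3) → not ⌊ i Fin.≟ i ⌋ ≡ false
  r zero = _≡_.refl
  r (suc zero) = _≡_.refl
  r (suc (suc zero)) = _≡_.refl

c5adj : Fin 5 → Fin 5 → Bool
c5adj i j = ⌊ j Fin.≟ Fin.fromℕ< {(Fin.toℕ i ℕ.+ 1) ℕ.% 5} (Data.Nat.DivMod.m%n<n (Fin.toℕ i ℕ.+ 1) 5) ⌋
          Data.Bool.∨ ⌊ i Fin.≟ Fin.fromℕ< {(Fin.toℕ j ℕ.+ 1) ℕ.% 5} (Data.Nat.DivMod.m%n<n (Fin.toℕ j ℕ.+ 1) 5) ⌋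
  where import Data.Nat.DivMod
        import Data.Bool

C5 : Graph 5
C5 = record { adj = c5adj ; sym = s ; irrefl = r }
  where
  s : ∀ i j → c5adj i j ≡ c5adj j i
  s zero zero = _≡_.refl
  s zero (suc zero) = _≡_.refl
  s zero (suc (suc zero)) = _≡_.refl
  s zero (suc (suc (suc zero))) = _≡_.refl
  s zero (suc (suc (suc (suc zero)))) = _≡_.refl
  s (suc zero) zero = _≡_.refl
  s (suc zero) (suc zero) = _≡_.refl
  s (suc zero) (suc (suc zero)) = _≡_.refl
  s (suc zero) (suc (suc (suc zero))) = _≡_.refl
  s (suc zero) (suc (suc (suc (suc zero)))) = _≡_.refl
  s (suc (suc zero)) zero = _≡_.refl
  s (suc (suc zero)) (suc zero) = _≡_.refl
  s (suc (suc zero)) (suc (suc zero)) = _≡_.refl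
  s (suc (suc zero)) (suc (suc (suc zero))) = _≡_.refl
  s (suc (suc zero)) (suc (suc (suc (suc zero)))) = _≡_.refl
  s (suc (suc (suc zero))) zero = _≡_.refl
  s (suc (suc (suc zero))) (suc zero) = _≡_.refl
  s (suc (suc (suc zero))) (suc (suc zero)) = _≡_.refl
  s (suc (suc (suc zero))) (suc (suc (suc zero))) = _≡_.refl
  s (suc (suc (suc zero))) (suc (suc (suc (suc zero)))) = _≡_.refl
  s (suc (suc (suc (suc zero)))) zero = _≡_.refl
  s (suc (suc (suc (suc zero)))) (suc zero) = _≡_.refl
  s (suc (suc (suc (suc zero)))) (suc (suc zero)) = _≡_.refl
  s (suc (suc (suc (suc zero)))) (suc (suc (suc zero))) = _≡_.refl
  s (suc (suc (suc (suc zero)))) (suc (suc (suc (suc zero)))) = _≡_.refl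
  r : ∀ i → c5adj i i ≡ false
  r zero = _≡_.refl
  r (suc zero) = _≡_.refl
  r (suc (suc zero)) = _≡_.refl
  r (suc (suc (suc zero))) = _≡_.refl
  r (suc (suc (suc (suc zero)))) = _≡_.refl

val : ∀ {k l m} → ℚ → Graph k → Graph l → Graph (suc m) → ℚ
val lam H1 H2 G = lam * t H1 G + ((1ℚ + 1ℚ) - lam) * tc H2 G

-- Predicates expressing c_λ(H1,H2) = liminf_n [λ t(H1,G_n) + (2-λ) t(H2, complement G_n)]
-- compared with a rational q.  Since (G_n) enumerates every finite graph once, and only
-- finitely many graphs have a given number of vertices, the tail {G_n : n ≥ n0} ranges
-- (up to finitely many exceptions) over all graphs with at least N vertices, so
--   liminf ≥ q  iff  ∀ ε>0 ∃ N, every graph G with v(G) ≥ N has value ≥ q - ε,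
--   liminf ≤ q  iff  ∀ ε>0 ∀ N, some graph G with v(G) ≥ N has value ≤ q + ε.
open import Data.Rational using (_≤_; _<_)
open import Data.Product using (Σ; _×_)

LiminfGe : ∀ {k l} → Graph k → Graph l → ℚ → ℚ → Set
LiminfGe H1 H2 lam q =
  ∀ (ε : ℚ) → 0ℚ < ε →
  Σ ℕ λ N → ∀ (m : ℕ) → N ℕ.≤ suc m → (G : Graph (suc m)) →
    q - ε ≤ val lam H1 H2 G

LiminfLe : ∀ {k l} → Graph k → Graph l → ℚ → ℚ → Set
LiminfLe H1 H2 lam q =
  ∀ (ε : ℚ) → 0ℚ < ε → ∀ (N : ℕ) →
  Σ ℕ λ m → N ℕ.≤ suc m × Σ (Graph (suc m)) λ G →
    val lam H1 H2 G ≤ q + ε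

two : ℚ
two = 1ℚ + 1ℚ

{-# OPTIONS --safe #-}

-- Lower bound.  Let B be the complement of G with all loops added, n = v(G), and for a
-- vertex v put d = Σₓ B(v,x), w = Σₓ Σᵧ B(v,x) B(x,y), e = Σₓ Σᵧ B(x,y).  The flag algebra
-- certificate is
--   40 n² hom(K₃,G) + 96 hom(C₅,B) − 6 n⁵
--     = Σᵥ [15 (4w − nd − e)² + 105 (nd − e)² + 30 (2e − n²)²] + (a sum of Φ over 5-tuples),
-- where Φ depends only on the graph induced by B on the 5-tuple and becomes nonnegative on
-- all 2¹⁰ graphs once it is averaged over the 120 orderings.  Removing the loops of B costs
-- O(n⁴) copies of C₅, which is absorbed by ε.
--
-- Upper bound.  Blow-ups of K₂ have limit densities (0, 1/16) and blow-ups of the triangular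
-- prism have (1/18, 17/432); both give 3/34 at λ = 10/17, the former being better for larger
-- λ and the latter for smaller λ.
module Submission where

open import Defs hiding (sym)
open import Algebra.Bundles using (CommutativeRing)
open import Data.Bool using (Bool; true; false; not; _∧_; if_then_else_)
open import Data.Bool.Properties using (not-involutive)
open import Data.Fin using (Fin; zero; suc; toℕ; quotient; _↑ˡ_; _↑ʳ_; _≟_)
open import Data.Fin.Patterns using (0F; 1F; 2F; 3F; 4F)
open import Data.Fin.Properties using (splitAt-↑ˡ; splitAt-↑ʳ)
open import Data.Integer as ℤ using (ℤ; +_; -[1+_]; 0ℤ; 1ℤ)
import Data.Integer.Properties as ℤ
open import Data.Integer.Tactic.RingSolver using (solve-∀)
open import Data.Nat as ℕ using (ℕ; zero; suc; z≤n; s≤s; NonZero)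
import Data.Nat.Properties as ℕ
import Data.Nat.Tactic.RingSolver as ℕ
open import Data.Product using (_×_; _,_)
open import Data.Sum using ([_,_]′)
open import Data.Unit using (⊤; tt)
open import Data.Vec using (Vec; []; _∷_; lookup; tabulate)
open import Data.Vec.Properties using (lookup∘tabulate)
open import Function using (_∘_)
open import Relation.Binary.PropositionalEquality
open import Relation.Nullary using (Dec)
open import Relation.Nullary.Decidable using (⌊_⌋; map′; _×-dec_; toWitness; isYes≗does)

-- The counting inequality

module CountingInequality where

  open import Algebra.Properties.Semiring.Sum (CommutativeRing.semiring ℤ.+-*-commutativeRing)
    using (sum-syntax; sum-cong-≗; ∑-distrib-+; ∑-comm; *-distribˡ-sum; *-distribʳ-sum)
  open import Data.Integer using (-_; _+_; _*_; _-_; _≤_; _≤?_; +≤+)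
  open import Data.Integer.Properties
    using (≤-refl; ≤-trans; ≤-reflexive; +-mono-≤; +-monoʳ-≤; *-monoˡ-≤-nonNeg; *-cancelˡ-≤-pos;
           *-zeroʳ; *-identityˡ; +-identityˡ; suc-*; pos-*; module ≤-Reasoning)

  Fun₅ : Set → Set
  Fun₅ V = V → V → V → V → V → ℤ

  module _ {V : Set} where
    infixl 6 _⊞_
    _⊞_ : Fun₅ V → Fun₅ V → Fun₅ V
    (f ⊞ g) a b c d e = f a b c d e + g a b c d e

    _≐_ : Fun₅ V → Fun₅ V → Set
    f ≐ g = ∀ a b c d e → f a b c d e ≡ g a b c d e

    -- sᵢ transposes the arguments i and i + 1.  Tᵢ sums over coset representatives for the
    -- symmetric group on the arguments i, …, 5 modulo the one on i + 1, …, 5, so the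
    -- composite symmetrises over all 120 permutations.
    s₁ s₂ s₃ s₄ T₁ T₂ T₃ T₄ symmetrise : Fun₅ V → Fun₅ V
    s₁ f a b c d e = f b a c d e
    s₂ f a b c d e = f a c b d e
    s₃ f a b c d e = f a b d c e
    s₄ f a b c d e = f a b c e d

    T₄ f = f ⊞ s₄ f
    T₃ f = f ⊞ s₃ (T₄ f)
    T₂ f = f ⊞ s₂ (T₃ f)
    T₁ f = f ⊞ s₁ (T₂ f)
    symmetrise f = T₄ (T₃ (T₂ (T₁ f)))

  ⟦_⟧ : Bool → ℤ
  ⟦ b ⟧ = if b then 1ℤ else 0ℤ

  module _ {V : Set} (B : V → V → Bool) where
    cotriangle : V → V → V → Bool
    cotriangle a b c = not (B a b) ∧ not (B a c) ∧ not (B b c)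

    -- The conjuncts follow the order in which `isHom C5` first meets the edges 01, 04, 12, 23, 34.
    pentagon : V → V → V → V → V → Bool
    pentagon a b c d e = B a b ∧ B a e ∧ B b c ∧ B c d ∧ B d e

  -- squares-sos decomposes these values; tabulating them keeps the evaluation in
  -- symmetrise-Φ-matrix≥0 fast.
  squares : Bool → Bool → Bool → Bool → ℤ
  squares false false false false = + 30
  squares false false false true  = - + 30
  squares false false true  false = + 30
  squares false false true  true  = - + 30
  squares false true  false false = - + 30
  squares false true  false true  = + 150
  squares false true  true  false = - + 120
  squares false true  true  true  = 0ℤ
  squares true  false false false = + 30
  squares true  false false true  = - + 120
  squares true  false true  false = + 150
  squares true  false true  true  = - + 60
  squares true  true  false false = - + 30
  squares true  true  false true  = 0ℤ
  squares true  true  true  false = - + 60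
  squares true  true  true  true  = + 90

  Φ : {V : Set} → (V → V → Bool) → Fun₅ V
  Φ B a b c d e =
    + 40 * ⟦ cotriangle B c d e ⟧ + + 96 * ⟦ pentagon B a b c d e ⟧
    - (+ 6 + squares (B a b) (B b c) (B a d) (B d e))

  -- The entry Vec Bool n of Table (suc n) is the row of the first vertex; diagonals are true.
  Table : ℕ → Set
  Table zero    = ⊤
  Table (suc n) = Vec Bool n × Table n

  matrix : ∀ {n} → Table n → Fin n → Fin n → Bool
  matrix {suc n} (r , t) zero    zero    = true
  matrix {suc n} (r , t) zero    (suc j) = lookup r j
  matrix {suc n} (r , t) (suc i) zero    = lookup r i
  matrix {suc n} (r , t) (suc i) (suc j) = matrix t i j

  -- Exhaustive check of the symmetrised certificate.

  ∀Vec? : ∀ {n} {P : Vec Bool n → Set} → (∀ v → Dec (P v)) → Dec (∀ v → P v)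
  ∀Vec? {zero}  P? = map′ (λ { p [] → p }) (λ p → p []) (P? [])
  ∀Vec? {suc n} P? =
    map′ (λ { (p , q) (true ∷ v) → p v ; (p , q) (false ∷ v) → q v })
         (λ p → (λ v → p (true ∷ v)) , (λ v → p (false ∷ v)))
         (∀Vec? (λ v → P? (true ∷ v)) ×-dec ∀Vec? (λ v → P? (false ∷ v)))

  ∀Table? : ∀ {n} {P : Table n → Set} → (∀ v → Dec (P v)) → Dec (∀ v → P v)
  ∀Table? {zero}  P? = map′ (λ p _ → p) (λ p → p tt) (P? tt)
  ∀Table? {suc n} P? =
    map′ (λ p → λ { (r , t) → p r t }) (λ p r t → p (r , t))
         (∀Vec? λ r → ∀Table? λ t → P? (r , t))

  -- Evaluation of the decision procedure during type checking goes through all 2^10 tables.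
  -- Nonnegativity holds only after symmetrisation: for instance, `Φ` itself is -156 when `B b c`
  -- and `B d e` hold but `B a b`, `B a d` fail.
  symmetrise-Φ-matrix≥0 : (t : Table 5) → 0ℤ ≤ symmetrise (Φ (matrix t)) 0F 1F 2F 3F 4F
  symmetrise-Φ-matrix≥0 = toWitness {a? = ∀Table? λ t → 0ℤ ≤? symmetrise (Φ (matrix t)) 0F 1F 2F 3F 4F} tt

  module _ {V : Set} {f g : Fun₅ V} where
    T₄-cong : f ≐ g → T₄ f ≐ T₄ g
    T₄-cong p a b c d e = cong₂ _+_ (p a b c d e) (p a b c e d)

    T₃-cong : f ≐ g → T₃ f ≐ T₃ g
    T₃-cong p a b c d e = cong₂ _+_ (p a b c d e) (T₄-cong p a b d c e)

    T₂-cong : f ≐ g → T₂ f ≐ T₂ g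
    T₂-cong p a b c d e = cong₂ _+_ (p a b c d e) (T₃-cong p a c b d e)

    T₁-cong : f ≐ g → T₁ f ≐ T₁ g
    T₁-cong p a b c d e = cong₂ _+_ (p a b c d e) (T₂-cong p b a c d e)

  symmetrise-cong : {V : Set} {f g : Fun₅ V} → f ≐ g → symmetrise f ≐ symmetrise g
  symmetrise-cong p = T₄-cong (T₃-cong (T₂-cong (T₁-cong p)))

  Φ-cong : {V : Set} {B C : V → V → Bool} → (∀ i j → B i j ≡ C i j) →
           Φ B ≐ Φ C
  Φ-cong B≗C a b c d e
    rewrite B≗C a b | B≗C b c | B≗C a e | B≗C c d | B≗C d e | B≗C c e | B≗C a d = refl

  table : ∀ {n} → (Fin n → Fin n → Bool) → Table n
  table {zero}  M = tt
  table {suc n} M = tabulate (M zero ∘ suc) , table (λ i j → M (suc i) (suc j))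

  matrix-table : ∀ {n} {M : Fin n → Fin n → Bool} → (∀ i → M i i ≡ true) → (∀ i j → M i j ≡ M j i) →
                 ∀ i j → M i j ≡ matrix (table M) i j
  matrix-table           r s zero    zero    = r zero
  matrix-table {M = M}   r s zero    (suc j) = sym (lookup∘tabulate (M zero ∘ suc) j)
  matrix-table {M = M}   r s (suc i) zero    = trans (s (suc i) zero) (sym (lookup∘tabulate (M zero ∘ suc) i))
  matrix-table           r s (suc i) (suc j) = matrix-table (r ∘ suc) (λ i j → s (suc i) (suc j)) i j

  -- Pulling `B` back along `v` gives a symmetric 5 by 5 matrix with true diagonal, hence a table.
  -- Injectivity of `v` is not assumed: since `B` has all loops, a repeated vertex just produces
  -- `true` entries off the diagonal, so degenerate 5-tuples are among the tables already checked.
  symmetrise-Φ≥0 : {V : Set} {B : V → V → Bool} → (∀ i → B i i ≡ true) → (∀ i j → B i j ≡ B j i) →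
                   ∀ a b c d e → 0ℤ ≤ symmetrise (Φ B) a b c d e
  symmetrise-Φ≥0 {V} {B} r s a b c d e =
    subst (0ℤ ≤_) (sym (symmetrise-cong (Φ-cong (matrix-table {M = M} (r ∘ v) (λ i j → s (v i) (v j)))) 0F 1F 2F 3F 4F))
      (symmetrise-Φ-matrix≥0 (table M))
    where
    v : Fin 5 → V
    v 0F = a
    v 1F = b
    v 2F = c
    v 3F = d
    v 4F = e
    M : Fin 5 → Fin 5 → Bool
    M i j = B (v i) (v j)

  -- Sums over vertices and over 5-tuples.

  ∑-mono : ∀ {n} {f g : Fin n → ℤ} → (∀ i → f i ≤ g i) → ∑[ i < n ] f i ≤ ∑[ i < n ] g i
  ∑-mono {zero}  p = ≤-refl
  ∑-mono {suc n} p = +-mono-≤ (p zero) (∑-mono (p ∘ suc))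

  ∑-const : ∀ n x → ∑[ _ < n ] x ≡ + n * x
  ∑-const zero    x = refl
  ∑-const (suc n) x = trans (cong (_+_ x) (∑-const n x)) (sym (suc-* (+ n) x))

  ∑-nonneg : ∀ {n} {f : Fin n → ℤ} → (∀ i → 0ℤ ≤ f i) → 0ℤ ≤ ∑[ i < n ] f i
  ∑-nonneg {n} p = ≤-trans (≤-reflexive (sym (trans (∑-const n 0ℤ) (*-zeroʳ (+ n))))) (∑-mono p)

  ≟-suc : ∀ {n} (i j : Fin n) → ⌊ suc i ≟ suc j ⌋ ≡ ⌊ i ≟ j ⌋
  ≟-suc i j = trans (isYes≗does (suc i ≟ suc j)) (sym (isYes≗does (i ≟ j)))

  ∑-≟ : ∀ {n} (i : Fin n) → ∑[ j < n ] ⟦ ⌊ i ≟ j ⌋ ⟧ ≡ 1ℤ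
  ∑-≟ {suc n} zero    = cong (_+_ 1ℤ) (trans (∑-const n 0ℤ) (*-zeroʳ (+ n)))
  ∑-≟ {suc n} (suc i) = trans (+-identityˡ _) (trans (sum-cong-≗ λ j → cong ⟦_⟧ (≟-suc i j)) (∑-≟ i))

  square-nonneg : ∀ x → 0ℤ ≤ x * x
  square-nonneg (+ n)    = ≤-trans (+≤+ z≤n) (≤-reflexive (pos-* n n))
  square-nonneg -[1+ n ] = +≤+ z≤n

  module _ {n : ℕ} where
    private V = Fin n

    ∑₅ : Fun₅ V → ℤ
    ∑₅ f = ∑[ a < n ] ∑[ b < n ] ∑[ c < n ] ∑[ d < n ] ∑[ e < n ] f a b c d e

    ∑₅-cong : {f g : Fun₅ V} → f ≐ g → ∑₅ f ≡ ∑₅ g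
    ∑₅-cong p = sum-cong-≗ λ a → sum-cong-≗ λ b → sum-cong-≗ λ c → sum-cong-≗ λ d → sum-cong-≗ λ e → p a b c d e

    ∑₅-mono : {f g : Fun₅ V} → (∀ a b c d e → f a b c d e ≤ g a b c d e) → ∑₅ f ≤ ∑₅ g
    ∑₅-mono p = ∑-mono λ a → ∑-mono λ b → ∑-mono λ c → ∑-mono λ d → ∑-mono λ e → p a b c d e

    ∑₅-⊞ : (f g : Fun₅ V) → ∑₅ (f ⊞ g) ≡ ∑₅ f + ∑₅ g
    ∑₅-⊞ f g =
      trans (sum-cong-≗ λ a →
        trans (sum-cong-≗ λ b →
          trans (sum-cong-≗ λ c →
            trans (sum-cong-≗ λ d → ∑-distrib-+ (f a b c d) (g a b c d))
              (∑-distrib-+ (λ d → ∑[ e < n ] f a b c d e) (λ d → ∑[ e < n ] g a b c d e)))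
            (∑-distrib-+ (λ c → ∑[ d < n ] ∑[ e < n ] f a b c d e)
                           (λ c → ∑[ d < n ] ∑[ e < n ] g a b c d e)))
          (∑-distrib-+ (λ b → ∑[ c < n ] ∑[ d < n ] ∑[ e < n ] f a b c d e)
                         (λ b → ∑[ c < n ] ∑[ d < n ] ∑[ e < n ] g a b c d e)))
        (∑-distrib-+ (λ a → ∑[ b < n ] ∑[ c < n ] ∑[ d < n ] ∑[ e < n ] f a b c d e)
                       (λ a → ∑[ b < n ] ∑[ c < n ] ∑[ d < n ] ∑[ e < n ] g a b c d e))

    ∑₅-* : ∀ x (f : Fun₅ V) → ∑₅ (λ a b c d e → x * f a b c d e) ≡ x * ∑₅ f
    ∑₅-* x f = sym
      (trans (*-distribˡ-sum x λ a → ∑[ b < n ] ∑[ c < n ] ∑[ d < n ] ∑[ e < n ] f a b c d e) (sum-cong-≗ λ a →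
        trans (*-distribˡ-sum x λ b → ∑[ c < n ] ∑[ d < n ] ∑[ e < n ] f a b c d e) (sum-cong-≗ λ b →
          trans (*-distribˡ-sum x λ c → ∑[ d < n ] ∑[ e < n ] f a b c d e) (sum-cong-≗ λ c →
            trans (*-distribˡ-sum x λ d → ∑[ e < n ] f a b c d e) (sum-cong-≗ λ d →
              *-distribˡ-sum x (f a b c d))))))

    ∑₅-s₁ : (f : Fun₅ V) → ∑₅ (s₁ f) ≡ ∑₅ f
    ∑₅-s₁ f = ∑-comm λ a b → ∑[ c < n ] ∑[ d < n ] ∑[ e < n ] f b a c d e

    ∑₅-s₂ : (f : Fun₅ V) → ∑₅ (s₂ f) ≡ ∑₅ f
    ∑₅-s₂ f = sum-cong-≗ λ a → ∑-comm λ b c → ∑[ d < n ] ∑[ e < n ] f a c b d e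

    ∑₅-s₃ : (f : Fun₅ V) → ∑₅ (s₃ f) ≡ ∑₅ f
    ∑₅-s₃ f = sum-cong-≗ λ a → sum-cong-≗ λ b → ∑-comm λ c d → ∑[ e < n ] f a b d c e

    ∑₅-s₄ : (f : Fun₅ V) → ∑₅ (s₄ f) ≡ ∑₅ f
    ∑₅-s₄ f = sum-cong-≗ λ a → sum-cong-≗ λ b → sum-cong-≗ λ c → ∑-comm λ d e → f a b c e d

    -- Each `Tᵢ` for i < 4 adds to `f` a transposed copy of the next operator applied to `f`, so the
    -- multipliers grow by one: 2, 3, 4, 5, with product 120.
    ∑₅-⊞-* : ∀ {f g : Fun₅ V} k → ∑₅ g ≡ + k * ∑₅ f → ∑₅ (f ⊞ g) ≡ + suc k * ∑₅ f
    ∑₅-⊞-* {f} {g} k p = trans (∑₅-⊞ f g) (trans (cong (_+_ (∑₅ f)) p) (sym (suc-* (+ k) (∑₅ f))))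

    ∑₅-T₄ : (f : Fun₅ V) → ∑₅ (T₄ f) ≡ + 2 * ∑₅ f
    ∑₅-T₄ f = ∑₅-⊞-* {f} 1 (trans (∑₅-s₄ f) (sym (*-identityˡ (∑₅ f))))

    ∑₅-T₃ : (f : Fun₅ V) → ∑₅ (T₃ f) ≡ + 3 * ∑₅ f
    ∑₅-T₃ f = ∑₅-⊞-* {f} 2 (trans (∑₅-s₃ (T₄ f)) (∑₅-T₄ f))

    ∑₅-T₂ : (f : Fun₅ V) → ∑₅ (T₂ f) ≡ + 4 * ∑₅ f
    ∑₅-T₂ f = ∑₅-⊞-* {f} 3 (trans (∑₅-s₂ (T₃ f)) (∑₅-T₃ f))

    ∑₅-T₁ : (f : Fun₅ V) → ∑₅ (T₁ f) ≡ + 5 * ∑₅ f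
    ∑₅-T₁ f = ∑₅-⊞-* {f} 4 (trans (∑₅-s₁ (T₂ f)) (∑₅-T₂ f))

    ∑₅-symmetrise : (f : Fun₅ V) → ∑₅ (symmetrise f) ≡ + 120 * ∑₅ f
    ∑₅-symmetrise f
      rewrite ∑₅-T₄ (T₃ (T₂ (T₁ f))) | ∑₅-T₃ (T₂ (T₁ f)) | ∑₅-T₂ (T₁ f) | ∑₅-T₁ f = lem (∑₅ f)
      where
      lem : ∀ x → + 2 * (+ 3 * (+ 4 * (+ 5 * x))) ≡ + 120 * x
      lem = solve-∀

    -- Reordering the summation variables leaves `∑₅` unchanged, so the symmetrised function has 120
    -- times the sum of `f`, and `f` may be negative at individual tuples.
    ∑₅-nonneg-symmetrise : (f : Fun₅ V) → (∀ a b c d e → 0ℤ ≤ symmetrise f a b c d e) → 0ℤ ≤ ∑₅ f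
    ∑₅-nonneg-symmetrise f p = *-cancelˡ-≤-pos 0ℤ (∑₅ f) (+ 120)
      (subst (0ℤ ≤_) (∑₅-symmetrise f)
        (∑-nonneg λ a → ∑-nonneg λ b → ∑-nonneg λ c → ∑-nonneg λ d → ∑-nonneg λ e → p a b c d e))

    -- The two factors share only the root `a`; with `a` fixed, the sum over the other four
    -- variables is the square of `Q a`.
    ∑₅-square-nonneg : (q : V → V → V → ℤ) → 0ℤ ≤ ∑₅ (λ a b c d e → q a b c * q a d e)
    ∑₅-square-nonneg q = ∑-nonneg λ a → subst (0ℤ ≤_) (sym (factor a)) (square-nonneg (Q a))
      where
      Q : V → ℤ
      Q a = ∑[ b < n ] ∑[ c < n ] q a b c
      factor : ∀ a → ∑[ b < n ] ∑[ c < n ] ∑[ d < n ] ∑[ e < n ] (q a b c * q a d e) ≡ Q a * Q a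
      factor a = sym
        (trans (*-distribʳ-sum (Q a) λ b → ∑[ c < n ] q a b c) (sum-cong-≗ λ b →
          trans (*-distribʳ-sum (Q a) (q a b)) (sum-cong-≗ λ c →
            trans (*-distribˡ-sum (q a b c) λ d → ∑[ e < n ] q a d e) (sum-cong-≗ λ d →
              *-distribˡ-sum (q a b c) (q a d)))))

  -- Homomorphism counts as sums of indicators.

  pos-sumFin : ∀ n {f : Fin n → ℕ} {g : Fin n → ℤ} → (∀ i → + f i ≡ g i) →
               + sumFin n f ≡ ∑[ i < n ] g i
  pos-sumFin zero    p = refl
  pos-sumFin (suc n) p = cong₂ _+_ (p zero) (pos-sumFin n (p ∘ suc))

  pos-if : ∀ b → + (if b then 1 else 0) ≡ ⟦ b ⟧
  pos-if true  = refl
  pos-if false = refl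

  module _ {n : ℕ} where
    private V = Fin n

    pos-countMaps₃ : (P : (Fin 3 → V) → Bool) (Q : V → V → V → Bool) →
      (∀ f → P f ≡ Q (f 0F) (f 1F) (f 2F)) →
      + countMaps 3 n P ≡ ∑[ a < n ] ∑[ b < n ] ∑[ c < n ] ⟦ Q a b c ⟧
    pos-countMaps₃ P Q p =
      pos-sumFin n λ a → pos-sumFin n λ b → pos-sumFin n λ c →
      trans (pos-if (P _)) (cong ⟦_⟧ (p _))

    pos-countMaps₅ : (P : (Fin 5 → V) → Bool) (Q : V → V → V → V → V → Bool) →
      (∀ f → P f ≡ Q (f 0F) (f 1F) (f 2F) (f 3F) (f 4F)) →
      + countMaps 5 n P ≡ ∑₅ (λ a b c d e → ⟦ Q a b c d e ⟧)
    pos-countMaps₅ P Q p =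
      pos-sumFin n λ a → pos-sumFin n λ b → pos-sumFin n λ c → pos-sumFin n λ d → pos-sumFin n λ e →
      trans (pos-if (P _)) (cong ⟦_⟧ (p _))

    -- `isHom` tests every edge in both directions, while non-edges reduce away. `lem` treats the
    -- resulting conjunction, in which symmetry of `A` merges the duplicates; `isHom-C5` works the
    -- same way.
    isHom-K3 : ∀ {A : V → V → Bool} → (∀ i j → A i j ≡ A j i) → ∀ f →
      isHom K3 A f ≡ A (f 0F) (f 1F) ∧ A (f 0F) (f 2F) ∧ A (f 1F) (f 2F)
    isHom-K3 s f = lem (s (f 0F) (f 1F)) (s (f 0F) (f 2F)) (s (f 1F) (f 2F))
      where
      lem : ∀ {p p′ q q′ r r′} → p ≡ p′ → q ≡ q′ → r ≡ r′ →
        (p ∧ q ∧ true) ∧ (p′ ∧ r ∧ true) ∧ (q′ ∧ r′ ∧ true) ∧ true ≡ p ∧ q ∧ r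
      lem {false} refl refl refl = refl
      lem {true} {q = false} refl refl refl = refl
      lem {true} {q = true} {r = false} refl refl refl = refl
      lem {true} {q = true} {r = true} refl refl refl = refl

    isHom-C5 : ∀ {A : V → V → Bool} → (∀ i j → A i j ≡ A j i) → ∀ f →
      isHom C5 A f ≡ pentagon A (f 0F) (f 1F) (f 2F) (f 3F) (f 4F)
    isHom-C5 s f = lem (s (f 0F) (f 1F)) (s (f 0F) (f 4F)) (s (f 1F) (f 2F)) (s (f 2F) (f 3F)) (s (f 3F) (f 4F))
      where
      lem : ∀ {p p′ q q′ r r′ u u′ v v′} → p ≡ p′ → q ≡ q′ → r ≡ r′ → u ≡ u′ → v ≡ v′ →
        (p ∧ q ∧ true) ∧ (p′ ∧ r ∧ true) ∧ (r′ ∧ u ∧ true) ∧ (u′ ∧ v ∧ true) ∧ (q′ ∧ v′ ∧ true) ∧ true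
        ≡ p ∧ q ∧ r ∧ u ∧ v
      lem {false} refl refl refl refl refl = refl
      lem {true} {q = false} refl refl refl refl refl = refl
      lem {true} {q = true} {r = false} refl refl refl refl refl = refl
      lem {true} {q = true} {r = true} {u = false} refl refl refl refl refl = refl
      lem {true} {q = true} {r = true} {u = true} {v = false} refl refl refl refl refl = refl
      lem {true} {q = true} {r = true} {u = true} {v = true} refl refl refl refl refl = refl

  -- The sum of squares.

  squares-sos : ∀ p q r s → squares p q r s ≡
    + 15 * ((+ 4 * (⟦ p ⟧ * ⟦ q ⟧) - (⟦ p ⟧ + ⟦ q ⟧)) * (+ 4 * (⟦ r ⟧ * ⟦ s ⟧) - (⟦ r ⟧ + ⟦ s ⟧)))
    + (+ 105 * ((⟦ p ⟧ - ⟦ q ⟧) * (⟦ r ⟧ - ⟦ s ⟧))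
    + + 30 * ((+ 2 * ⟦ q ⟧ - 1ℤ) * (+ 2 * ⟦ s ⟧ - 1ℤ)))
  squares-sos false false false false = refl
  squares-sos false false false true  = refl
  squares-sos false false true  false = refl
  squares-sos false false true  true  = refl
  squares-sos false true  false false = refl
  squares-sos false true  false true  = refl
  squares-sos false true  true  false = refl
  squares-sos false true  true  true  = refl
  squares-sos true  false false false = refl
  squares-sos true  false false true  = refl
  squares-sos true  false true  false = refl
  squares-sos true  false true  true  = refl
  squares-sos true  true  false false = refl
  squares-sos true  true  false true  = refl
  squares-sos true  true  true  false = refl
  squares-sos true  true  true  true  = refl

  module _ {n : ℕ} (B : Fin n → Fin n → Bool) where
    private
      -- Summed over `b` and `c`, these give 4w - nd - e, nd - e and 2e - n^2 at the root `a`. All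
      -- three vanish on blow-ups of both extremal graphs, where `B` is regular of degree n/2, as a
      -- tight certificate requires.
      v₁ v₂ v₃ : Fin n → Fin n → Fin n → ℤ
      v₁ a b c = + 4 * (⟦ B a b ⟧ * ⟦ B b c ⟧) - (⟦ B a b ⟧ + ⟦ B b c ⟧)
      v₂ a b c = ⟦ B a b ⟧ - ⟦ B b c ⟧
      v₃ a b c = + 2 * ⟦ B b c ⟧ - 1ℤ

      _² : (Fin n → Fin n → Fin n → ℤ) → Fun₅ (Fin n)
      (q ²) a b c d e = q a b c * q a d e

    ∑₅-squares-nonneg : 0ℤ ≤ ∑₅ (λ a b c d e → squares (B a b) (B b c) (B a d) (B d e))
    ∑₅-squares-nonneg = ≤-trans
      (+-mono-≤ (nonneg 15 v₁) (+-mono-≤ (nonneg 105 v₂) (nonneg 30 v₃)))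
      (≤-reflexive (sym
        (trans (∑₅-cong λ a b c d e → squares-sos (B a b) (B b c) (B a d) (B d e))
        (trans (∑₅-⊞ (scaled 15 v₁) (scaled 105 v₂ ⊞ scaled 30 v₃))
          (cong (_+_ (∑₅ (scaled 15 v₁))) (∑₅-⊞ (scaled 105 v₂) (scaled 30 v₃)))))))
      where
      scaled : ℕ → (Fin n → Fin n → Fin n → ℤ) → Fun₅ (Fin n)
      scaled k q a b c d e = + k * (q ²) a b c d e
      nonneg : ∀ k q → 0ℤ ≤ ∑₅ (scaled k q)
      nonneg k q = ≤-trans (≤-reflexive (sym (*-zeroʳ (+ k))))
        (≤-trans (*-monoˡ-≤-nonNeg (+ k) (∑₅-square-nonneg q)) (≤-reflexive (sym (∑₅-* (+ k) (q ²)))))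

  -- Removing the loops, and the resulting counting bound.

  ∧-remove : ∀ x₁ x₂ x₃ x₄ x₅ d₁ d₂ d₃ d₄ d₅ →
    ⟦ x₁ ∧ x₂ ∧ x₃ ∧ x₄ ∧ x₅ ⟧
    ≤ ⟦ (x₁ ∧ not d₁) ∧ (x₂ ∧ not d₂) ∧ (x₃ ∧ not d₃) ∧ (x₄ ∧ not d₄) ∧ (x₅ ∧ not d₅) ⟧
      + (⟦ d₁ ⟧ + (⟦ d₂ ⟧ + (⟦ d₃ ⟧ + (⟦ d₄ ⟧ + ⟦ d₅ ⟧))))
  ∧-remove x₁ x₂ x₃ x₄ x₅ d₁ d₂ d₃ d₄ d₅ =
    toWitness {a? = ∀Vec? P?} tt (x₁ ∷ x₂ ∷ x₃ ∷ x₄ ∷ x₅ ∷ d₁ ∷ d₂ ∷ d₃ ∷ d₄ ∷ d₅ ∷ [])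
    where
    P : Vec Bool 10 → Set
    P (x₁ ∷ x₂ ∷ x₃ ∷ x₄ ∷ x₅ ∷ d₁ ∷ d₂ ∷ d₃ ∷ d₄ ∷ d₅ ∷ []) =
      ⟦ x₁ ∧ x₂ ∧ x₃ ∧ x₄ ∧ x₅ ⟧
      ≤ ⟦ (x₁ ∧ not d₁) ∧ (x₂ ∧ not d₂) ∧ (x₃ ∧ not d₃) ∧ (x₄ ∧ not d₄) ∧ (x₅ ∧ not d₅) ⟧
        + (⟦ d₁ ⟧ + (⟦ d₂ ⟧ + (⟦ d₃ ⟧ + (⟦ d₄ ⟧ + ⟦ d₅ ⟧))))
    P? : ∀ v → Dec (P v)
    P? (x₁ ∷ x₂ ∷ x₃ ∷ x₄ ∷ x₅ ∷ d₁ ∷ d₂ ∷ d₃ ∷ d₄ ∷ d₅ ∷ []) = _ ≤? _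

  ∑₅-const : ∀ n x → ∑₅ {n} (λ _ _ _ _ _ → x) ≡ + n * (+ n * (+ n * (+ n * (+ n * x))))
  ∑₅-const n x =
    trans (∑-const n (∑[ _ < n ] ∑[ _ < n ] ∑[ _ < n ] ∑[ _ < n ] x)) (cong (_*_ (+ n))
    (trans (∑-const n (∑[ _ < n ] ∑[ _ < n ] ∑[ _ < n ] x)) (cong (_*_ (+ n))
    (trans (∑-const n (∑[ _ < n ] ∑[ _ < n ] x)) (cong (_*_ (+ n))
    (trans (∑-const n (∑[ _ < n ] x)) (cong (_*_ (+ n)) (∑-const n x))))))))

  ≟-sym : ∀ {n} (i j : Fin n) → ⌊ i ≟ j ⌋ ≡ ⌊ j ≟ i ⌋
  ≟-sym zero    zero    = refl
  ≟-sym zero    (suc j) = refl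
  ≟-sym (suc i) zero    = refl
  ≟-sym (suc i) (suc j) = trans (≟-suc i j) (trans (≟-sym i j) (sym (≟-suc j i)))

  coadj : ∀ {n} → Graph n → Fin n → Fin n → Bool
  coadj G x y = not (adj G x y)

  module _ {n : ℕ} (G : Graph n) where
    private
      N = + n
      K = + hom K3 (adj G)
      C = + hom C5 (compl G)

      B = coadj G

      N⁴ = N * (N * (N * (N * 1ℤ)))

      δ : Fin n → Fin n → ℤ
      δ i j = ⟦ ⌊ i ≟ j ⌋ ⟧

    B-sym : ∀ i j → B i j ≡ B j i
    B-sym i j = cong not (Graph.sym G i j)

    compl-sym : ∀ i j → compl G i j ≡ compl G j i
    compl-sym i j = cong₂ _∧_ (B-sym i j) (cong not (≟-sym i j))

    ∑₅-cotriangle : ∑₅ (λ a b c d e → ⟦ cotriangle B c d e ⟧) ≡ N * (N * K)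
    ∑₅-cotriangle =
      trans (∑-const n (∑[ _ < n ] cotriangles)) (cong (_*_ N) (trans (∑-const n cotriangles) (cong (_*_ N)
        (sym (pos-countMaps₃ (isHom K3 (adj G)) (cotriangle B) λ f →
          trans (isHom-K3 (Graph.sym G) f) (not-not f))))))
      where
      not-not : ∀ f → adj G (f 0F) (f 1F) ∧ adj G (f 0F) (f 2F) ∧ adj G (f 1F) (f 2F) ≡ cotriangle B (f 0F) (f 1F) (f 2F)
      not-not f = sym (cong₂ _∧_ (not-involutive (adj G (f 0F) (f 1F)))
        (cong₂ _∧_ (not-involutive (adj G (f 0F) (f 2F))) (not-involutive (adj G (f 1F) (f 2F)))))
      cotriangles = ∑[ c < n ] ∑[ d < n ] ∑[ e < n ] ⟦ cotriangle B c d e ⟧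

    ∑₅-pentagon-compl : ∑₅ (λ a b c d e → ⟦ pentagon (compl G) a b c d e ⟧) ≡ C
    ∑₅-pentagon-compl = sym (pos-countMaps₅ (isHom C5 (compl G)) (pentagon (compl G)) (isHom-C5 compl-sym))

    ∑₅-δ : ∑₅ {n} (λ a b c d e → δ d e) ≡ N⁴
    ∑₅-δ = trans {j = ∑[ _ < n ] ∑[ _ < n ] ∑[ _ < n ] ∑[ _ < n ] 1ℤ}
        (sum-cong-≗ {n} λ a → sum-cong-≗ {n} λ b → sum-cong-≗ {n} λ c → sum-cong-≗ {n} ∑-≟)
      (trans (∑-const n (∑[ _ < n ] ∑[ _ < n ] ∑[ _ < n ] 1ℤ)) (cong (_*_ N)
      (trans (∑-const n (∑[ _ < n ] ∑[ _ < n ] 1ℤ)) (cong (_*_ N)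
      (trans (∑-const n (∑[ _ < n ] 1ℤ)) (cong (_*_ N) (∑-const n 1ℤ)))))))

    -- The complement counted in tc has no loops whereas coadj G has all of them: deleting
    -- the loops destroys only closed walks with two equal consecutive vertices.
    loops : Fun₅ (Fin n)
    loops = (λ a b c d e → δ a b) ⊞ ((λ a b c d e → δ a e) ⊞ ((λ a b c d e → δ b c) ⊞
            ((λ a b c d e → δ c d) ⊞ (λ a b c d e → δ d e))))

    ∑₅-loops : ∑₅ loops ≡ N⁴ + (N⁴ + (N⁴ + (N⁴ + N⁴)))
    ∑₅-loops =
      trans (∑₅-⊞ ab _) (cong₂ _+_ ∑ab (trans (∑₅-⊞ ae _) (cong₂ _+_ ∑ae
      (trans (∑₅-⊞ bc _) (cong₂ _+_ ∑bc (trans (∑₅-⊞ cd _) (cong₂ _+_ ∑cd ∑₅-δ)))))))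
      where
      ab ae bc cd : Fun₅ (Fin n)
      ab a b c d e = δ a b
      ae a b c d e = δ a e
      bc a b c d e = δ b c
      cd a b c d e = δ c d
      -- Adjacent transpositions carry each indicator to one already summed: `cd` to `δ d e`, `bc`
      -- to `cd`, `ab` to `bc`, and `ae` to `ab`. The permuted functions agree by computation.
      ∑cd : ∑₅ cd ≡ N⁴
      ∑cd = trans (sym (trans (∑₅-s₃ (s₄ cd)) (∑₅-s₄ cd))) ∑₅-δ
      ∑bc : ∑₅ bc ≡ N⁴
      ∑bc = trans (sym (trans (∑₅-s₂ (s₃ bc)) (∑₅-s₃ bc))) ∑cd
      ∑ab : ∑₅ ab ≡ N⁴
      ∑ab = trans (sym (trans (∑₅-s₁ (s₂ ab)) (∑₅-s₂ ab))) ∑bc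
      ∑ae : ∑₅ ae ≡ N⁴
      ∑ae = trans (sym (trans (∑₅-s₂ (s₃ (s₄ ae))) (trans (∑₅-s₃ (s₄ ae)) (∑₅-s₄ ae)))) ∑ab

    ∑₅-pentagon-B : ∑₅ (λ a b c d e → ⟦ pentagon B a b c d e ⟧) ≤ C + (N⁴ + (N⁴ + (N⁴ + (N⁴ + N⁴))))
    ∑₅-pentagon-B = ≤-trans
      (∑₅-mono λ a b c d e → ∧-remove (B a b) (B a e) (B b c) (B c d) (B d e)
        ⌊ a ≟ b ⌋ ⌊ a ≟ e ⌋ ⌊ b ≟ c ⌋ ⌊ c ≟ d ⌋ ⌊ d ≟ e ⌋)
      (≤-reflexive (trans (∑₅-⊞ (λ a b c d e → ⟦ pentagon (compl G) a b c d e ⟧) loops)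
        (cong₂ _+_ ∑₅-pentagon-compl ∑₅-loops)))

    -- The subtracted part of `Φ` is moved to the left, so that only sums and scalar multiples have
    -- to be pulled through `∑₅`.
    ∑₅-Φ : ∑₅ (Φ B) + (N * (N * (N * (N * (N * + 6)))) + ∑₅ (λ a b c d e → squares (B a b) (B b c) (B a d) (B d e)))
      ≡ + 40 * (N * (N * K)) + + 96 * ∑₅ (λ a b c d e → ⟦ pentagon B a b c d e ⟧)
    ∑₅-Φ =
      trans (sym (trans (∑₅-⊞ (Φ B) (six ⊞ sq))
        (cong (_+_ (∑₅ (Φ B))) (trans (∑₅-⊞ six sq) (cong (_+ ∑₅ sq) (∑₅-const n (+ 6)))))))
      (trans (∑₅-cong λ a b c d e → i-j+j≡i (tri a b c d e + pent a b c d e) (+ 6 + sq a b c d e))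
      (trans (∑₅-⊞ tri pent)
        (cong₂ _+_ (trans (∑₅-* (+ 40) λ a b c d e → ⟦ cotriangle B c d e ⟧) (cong (_*_ (+ 40)) ∑₅-cotriangle))
                   (∑₅-* (+ 96) λ a b c d e → ⟦ pentagon B a b c d e ⟧))))
      where
      tri pent six sq : Fun₅ (Fin n)
      tri a b c d e = + 40 * ⟦ cotriangle B c d e ⟧
      pent a b c d e = + 96 * ⟦ pentagon B a b c d e ⟧
      six a b c d e = + 6
      sq a b c d e = squares (B a b) (B b c) (B a d) (B d e)
      i-j+j≡i : ∀ i j → (i - j) + j ≡ i
      i-j+j≡i = solve-∀

    -- Division by 68 n^5 turns the coefficients 6, 40 and 96 into 3/34, 10/17 and 24/17 = 2 -
    -- 10/17, and leaves the loop correction 480/(68 n) = 120/(17 n).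
    density-bound : + 6 * (N * N * N * N * N) ≤ + 40 * (N * N * K) + + 96 * (C + + 5 * (N * N * N * N))
    density-bound = begin
      + 6 * (N * N * N * N * N)   ≡⟨ lhs N ⟩
      0ℤ + (N * (N * (N * (N * (N * + 6)))) + 0ℤ)
        ≤⟨ +-mono-≤ (∑₅-nonneg-symmetrise (Φ B) (symmetrise-Φ≥0 (λ i → cong not (Graph.irrefl G i)) B-sym))
            (+-monoʳ-≤ (N * (N * (N * (N * (N * + 6))))) (∑₅-squares-nonneg B)) ⟩
      ∑₅ (Φ B) + (N * (N * (N * (N * (N * + 6)))) + ∑₅ (λ a b c d e → squares (B a b) (B b c) (B a d) (B d e)))
        ≡⟨ ∑₅-Φ ⟩
      + 40 * (N * (N * K)) + + 96 * ∑₅ (λ a b c d e → ⟦ pentagon B a b c d e ⟧)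
        ≤⟨ +-monoʳ-≤ (+ 40 * (N * (N * K))) (*-monoˡ-≤-nonNeg (+ 96) ∑₅-pentagon-B) ⟩
      + 40 * (N * (N * K)) + + 96 * (C + (N⁴ + (N⁴ + (N⁴ + (N⁴ + N⁴)))))
        ≡⟨ rhs N K C ⟩
      + 40 * (N * N * K) + + 96 * (C + + 5 * (N * N * N * N)) ∎
      where
      open ≤-Reasoning
      lhs : ∀ N → + 6 * (N * N * N * N * N) ≡ 0ℤ + (N * (N * (N * (N * (N * + 6)))) + 0ℤ)
      lhs = solve-∀
      rhs : ∀ N K C → + 40 * (N * (N * K)) + + 96 * (C +
        (N * (N * (N * (N * 1ℤ))) + (N * (N * (N * (N * 1ℤ))) + (N * (N * (N * (N * 1ℤ))) +
        (N * (N * (N * (N * 1ℤ))) + N * (N * (N * (N * 1ℤ))))))))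
        ≡ + 40 * (N * N * K) + + 96 * (C + + 5 * (N * N * N * N))
      rhs = solve-∀

open CountingInequality using (coadj; density-bound)

-- Fractions

open import Data.Rational using (ℚ; mkℚ; ↥_; ↧ₙ_; 0ℚ; 1ℚ; _/_; _+_; _*_; _-_; -_; _≤_; _<_; _≤?_; *<*; toℚᵘ; nonNegative)
open import Data.Rational.Properties hiding (_≟_; _≤?_)
open import Data.Rational.Solver using (module +-*-Solver)
import Data.Rational.Unnormalised as ℚᵘ
import Data.Rational.Unnormalised.Properties as ℚᵘ

toℚᵘ-/ : ∀ i d .{{_ : NonZero d}} → toℚᵘ (i / d) ℚᵘ.≃ i ℚᵘ./ d
toℚᵘ-/ i (suc d) = toℚᵘ-fromℚᵘ (ℚᵘ.mkℚᵘ i d)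

-- `_/_` cancels a gcd, so the comparison is made on unnormalised rationals, where the order is
-- cross-multiplication by definition.
/-mono-≤ : ∀ i d j e .{{_ : NonZero d}} .{{_ : NonZero e}} → i ℤ.* + e ℤ.≤ j ℤ.* + d → i / d ≤ j / e
/-mono-≤ i (suc d) j (suc e) p = toℚᵘ-cancel-≤
  (ℚᵘ.≤-respʳ-≃ (ℚᵘ.≃-sym (toℚᵘ-/ j (suc e))) (ℚᵘ.≤-respˡ-≃ (ℚᵘ.≃-sym (toℚᵘ-/ i (suc d))) (ℚᵘ.*≤* p)))

/-cross : ∀ i d j e .{{_ : NonZero d}} .{{_ : NonZero e}} → i ℤ.* + e ≡ j ℤ.* + d → i / d ≡ j / e
/-cross i d j e p = ≤-antisym (/-mono-≤ i d j e (ℤ.≤-reflexive p)) (/-mono-≤ j e i d (ℤ.≤-reflexive (sym p)))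

/-* : ∀ i d j e .{{_ : NonZero d}} .{{_ : NonZero e}} .{{_ : NonZero (d ℕ.* e)}} →
      (i / d) * (j / e) ≡ (i ℤ.* j) / (d ℕ.* e)
/-* i d@(suc _) j e@(suc _) = toℚᵘ-injective
  (ℚᵘ.≃-trans (toℚᵘ-homo-* (i / d) (j / e))
  (ℚᵘ.≃-trans (ℚᵘ.*-cong (toℚᵘ-/ i d) (toℚᵘ-/ j e)) (ℚᵘ.≃-sym (toℚᵘ-/ (i ℤ.* j) (d ℕ.* e)))))

/-+ : ∀ i j d .{{_ : NonZero d}} → (i / d) + (j / d) ≡ (i ℤ.+ j) / d
/-+ i j d@(suc _) = toℚᵘ-injective
  (ℚᵘ.≃-trans (toℚᵘ-homo-+ (i / d) (j / d))
  (ℚᵘ.≃-trans (ℚᵘ.+-cong (toℚᵘ-/ i d) (toℚᵘ-/ j d))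
  (ℚᵘ.≃-trans (ℚᵘ.*≡* (lem i j (+ d))) (ℚᵘ.≃-sym (toℚᵘ-/ (i ℤ.+ j) d)))))
  where
  lem : ∀ i j d → (i ℤ.* d ℤ.+ j ℤ.* d) ℤ.* d ≡ (i ℤ.+ j) ℤ.* (d ℤ.* d)
  lem = solve-∀

-- From counts to densities: the lower bound.

module _ (n : ℕ) where
  private N = + n

  pos-^ : ∀ k → + (n ℕ.^ k) ≡ N ℤ.^ k
  pos-^ zero    = refl
  pos-^ (suc k) = trans (ℤ.pos-* n (n ℕ.^ k)) (cong (ℤ._*_ N) (pos-^ k))

  pos-^³ : + (n ℕ.^ 3) ≡ N ℤ.* N ℤ.* N
  pos-^³ = trans (pos-^ 3) (lem N)
    where
    lem : ∀ N → N ℤ.* (N ℤ.* (N ℤ.* 1ℤ)) ≡ N ℤ.* N ℤ.* N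
    lem = solve-∀

  pos-^⁴ : + (n ℕ.^ 4) ≡ N ℤ.* N ℤ.* N ℤ.* N
  pos-^⁴ = trans (pos-^ 4) (lem N)
    where
    lem : ∀ N → N ℤ.* (N ℤ.* (N ℤ.* (N ℤ.* 1ℤ))) ≡ N ℤ.* N ℤ.* N ℤ.* N
    lem = solve-∀

  pos-^⁵ : + (n ℕ.^ 5) ≡ N ℤ.* N ℤ.* N ℤ.* N ℤ.* N
  pos-^⁵ = trans (pos-^ 5) (lem N)
    where
    lem : ∀ N → N ℤ.* (N ℤ.* (N ℤ.* (N ℤ.* (N ℤ.* 1ℤ)))) ≡ N ℤ.* N ℤ.* N ℤ.* N ℤ.* N
    lem = solve-∀

-- A positive ε has numerator at least 1, so with denominator q it is at least 1/q. The left side is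
-- a/(bn), which is at most 1/(bq) once aq is at most n; hence the threshold 120 q for the loop
-- error.
small-error : ∀ a b n .{{_ : NonZero b}} .{{_ : NonZero (b ℕ.* n ℕ.^ 5)}} ε → 0ℚ < ε →
              a ℕ.* ↧ₙ ε ℕ.≤ n → + (a ℕ.* n ℕ.^ 4) / (b ℕ.* n ℕ.^ 5) ≤ ε
small-error a b n ε@(mkℚ (+ suc p) q-1 _) _ q≤n = ≤-trans
  (/-mono-≤ (+ (a ℕ.* n ℕ.^ 4)) (b ℕ.* n ℕ.^ 5) (↥ ε) (↧ₙ ε)
    (subst₂ ℤ._≤_ (ℤ.pos-* (a ℕ.* n ℕ.^ 4) q) (ℤ.pos-* (suc p) (b ℕ.* n ℕ.^ 5)) (ℤ.+≤+ (begin
      a ℕ.* n ℕ.^ 4 ℕ.* q     ≡⟨ ℕ.*-assoc a (n ℕ.^ 4) q ⟩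
      a ℕ.* (n ℕ.^ 4 ℕ.* q)   ≡⟨ cong (ℕ._*_ a) (ℕ.*-comm (n ℕ.^ 4) q) ⟩
      a ℕ.* (q ℕ.* n ℕ.^ 4)   ≡⟨ ℕ.*-assoc a q (n ℕ.^ 4) ⟨
      a ℕ.* q ℕ.* n ℕ.^ 4     ≤⟨ ℕ.*-monoˡ-≤ (n ℕ.^ 4) q≤n ⟩
      n ℕ.^ 5                 ≤⟨ ℕ.m≤n*m (n ℕ.^ 5) b ⟩
      b ℕ.* n ℕ.^ 5           ≤⟨ ℕ.m≤n*m (b ℕ.* n ℕ.^ 5) (suc p) ⟩
      suc p ℕ.* (b ℕ.* n ℕ.^ 5) ∎))))
  (≤-reflexive (↥p/↧p≡p ε))
  where
  open ℕ.≤-Reasoning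
  q = suc q-1
small-error a b n (mkℚ (+ zero) _ _) (*<* (ℤ.+<+ ()))
small-error a b n (mkℚ -[1+ p ] _ _) (*<* ())

-- K and C stand for the homomorphism counts.  N is a separate variable because products of
-- + n would unfold during conversion checking.
module _ (n : ℕ) .{{_ : NonZero n}} (K C N : ℤ) (N≡n : N ≡ + n) where
  private
    instance
      n³≢0 = ℕ.m^n≢0 n 3
      n⁵≢0 = ℕ.m^n≢0 n 5
      17n³≢0 = ℕ.m*n≢0 17 (n ℕ.^ 3)
      17n⁵≢0 = ℕ.m*n≢0 17 (n ℕ.^ 5)

    pos-17n³ : + (17 ℕ.* n ℕ.^ 3) ≡ + 17 ℤ.* (N ℤ.* N ℤ.* N)
    pos-17n³ rewrite N≡n = trans (ℤ.pos-* 17 (n ℕ.^ 3)) (cong (ℤ._*_ (+ 17)) (pos-^³ n))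

    pos-17n⁵ : + (17 ℕ.* n ℕ.^ 5) ≡ + 17 ℤ.* (N ℤ.* N ℤ.* N ℤ.* N ℤ.* N)
    pos-17n⁵ rewrite N≡n = trans (ℤ.pos-* 17 (n ℕ.^ 5)) (cong (ℤ._*_ (+ 17)) (pos-^⁵ n))

    pos-120n⁴ : + (120 ℕ.* n ℕ.^ 4) ≡ + 120 ℤ.* (N ℤ.* N ℤ.* N ℤ.* N)
    pos-120n⁴ rewrite N≡n = trans (ℤ.pos-* 120 (n ℕ.^ 4)) (cong (ℤ._*_ (+ 120)) (pos-^⁴ n))

    v error : ℚ
    v = + 10 / 17 * (K / (n ℕ.^ 3)) + ((1ℚ + 1ℚ) - + 10 / 17) * (C / (n ℕ.^ 5))
    error = + (120 ℕ.* n ℕ.^ 4) / (17 ℕ.* n ℕ.^ 5)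

    K′ C′ : ℤ
    K′ = + 10 ℤ.* (N ℤ.* N ℤ.* K)
    C′ = + 24 ℤ.* C

    v≡ : v ≡ (K′ ℤ.+ C′) / (17 ℕ.* n ℕ.^ 5)
    v≡ = trans (cong₂ _+_ K-term (trans (cong (_* (C / (n ℕ.^ 5))) 2-10/17) (/-* (+ 24) 17 C (n ℕ.^ 5))))
      (/-+ K′ C′ (17 ℕ.* n ℕ.^ 5))
      where
      lem : ∀ K N → + 10 ℤ.* K ℤ.* (+ 17 ℤ.* (N ℤ.* N ℤ.* N ℤ.* N ℤ.* N))
        ≡ + 10 ℤ.* (N ℤ.* N ℤ.* K) ℤ.* (+ 17 ℤ.* (N ℤ.* N ℤ.* N))
      lem = solve-∀
      2-10/17 : (1ℚ + 1ℚ) - + 10 / 17 ≡ + 24 / 17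
      2-10/17 = refl
      K-term : + 10 / 17 * (K / (n ℕ.^ 3)) ≡ K′ / (17 ℕ.* n ℕ.^ 5)
      K-term = trans (/-* (+ 10) 17 K (n ℕ.^ 3))
        (/-cross (+ 10 ℤ.* K) (17 ℕ.* n ℕ.^ 3) K′ (17 ℕ.* n ℕ.^ 5)
          (trans (cong (ℤ._*_ (+ 10 ℤ.* K)) pos-17n⁵)
          (trans (lem K N) (sym (cong (ℤ._*_ K′) pos-17n³)))))

  module _ (bound : + 6 ℤ.* (N ℤ.* N ℤ.* N ℤ.* N ℤ.* N) ℤ.≤
                    + 40 ℤ.* (N ℤ.* N ℤ.* K) ℤ.+ + 96 ℤ.* (C ℤ.+ + 5 ℤ.* (N ℤ.* N ℤ.* N ℤ.* N))) where
    private
      3/34≤v+error : + 3 / 34 ≤ v + error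
      3/34≤v+error = ≤-trans
        (/-mono-≤ (+ 3) 34 S (17 ℕ.* n ℕ.^ 5)
        -- Doubling makes the cross-multiplied inequality exactly 17 times `bound`, since 68 = 2 *
        -- 34 clears the common factor 4 of 40 and 96.
        (ℤ.*-cancelˡ-≤-pos (+ 3 ℤ.* + (17 ℕ.* n ℕ.^ 5)) (S ℤ.* + 34) (+ 2) (begin
          + 2 ℤ.* (+ 3 ℤ.* + (17 ℕ.* n ℕ.^ 5))
            ≡⟨ cong (λ z → + 2 ℤ.* (+ 3 ℤ.* z)) pos-17n⁵ ⟩
          + 2 ℤ.* (+ 3 ℤ.* (+ 17 ℤ.* (N ℤ.* N ℤ.* N ℤ.* N ℤ.* N))) ≡⟨ lhs (N ℤ.* N ℤ.* N ℤ.* N ℤ.* N) ⟩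
          + 17 ℤ.* (+ 6 ℤ.* (N ℤ.* N ℤ.* N ℤ.* N ℤ.* N)) ≤⟨ ℤ.*-monoˡ-≤-nonNeg (+ 17) bound ⟩
          + 17 ℤ.* (+ 40 ℤ.* (N ℤ.* N ℤ.* K) ℤ.+ + 96 ℤ.* (C ℤ.+ + 5 ℤ.* (N ℤ.* N ℤ.* N ℤ.* N)))
            ≡⟨ rhs (N ℤ.* N ℤ.* K) C (N ℤ.* N ℤ.* N ℤ.* N) ⟩
          + 2 ℤ.* ((K′ ℤ.+ C′ ℤ.+ + 120 ℤ.* (N ℤ.* N ℤ.* N ℤ.* N)) ℤ.* + 34)
            ≡⟨ cong (λ z → + 2 ℤ.* ((K′ ℤ.+ C′ ℤ.+ z) ℤ.* + 34)) pos-120n⁴ ⟨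
          + 2 ℤ.* (S ℤ.* + 34) ∎)))
        (≤-reflexive (sym (trans (cong (_+ error) v≡) (/-+ (K′ ℤ.+ C′) (+ (120 ℕ.* n ℕ.^ 4)) (17 ℕ.* n ℕ.^ 5)))))
        where
        open ℤ.≤-Reasoning
        S = K′ ℤ.+ C′ ℤ.+ + (120 ℕ.* n ℕ.^ 4)
        lhs : ∀ x → + 2 ℤ.* (+ 3 ℤ.* (+ 17 ℤ.* x)) ≡ + 17 ℤ.* (+ 6 ℤ.* x)
        lhs = solve-∀
        rhs : ∀ x y z → + 17 ℤ.* (+ 40 ℤ.* x ℤ.+ + 96 ℤ.* (y ℤ.+ + 5 ℤ.* z))
          ≡ + 2 ℤ.* ((+ 10 ℤ.* x ℤ.+ + 24 ℤ.* y ℤ.+ + 120 ℤ.* z) ℤ.* + 34)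
        rhs = solve-∀

    3/34-ε≤v : ∀ ε → 0ℚ < ε → 120 ℕ.* ↧ₙ ε ℕ.≤ n → + 3 / 34 - ε ≤ v
    3/34-ε≤v ε 0<ε q≤n = begin
      + 3 / 34 - ε     ≤⟨ +-monoˡ-≤ (- ε) (≤-trans 3/34≤v+error (+-monoʳ-≤ v (small-error 120 17 n ε 0<ε q≤n))) ⟩
      (v + ε) - ε      ≡⟨ +-assoc v ε (- ε) ⟩
      v + (ε - ε)      ≡⟨ cong (_+_ v) (+-inverseʳ ε) ⟩
      v + 0ℚ           ≡⟨ +-identityʳ v ⟩
      v                ∎
      where open ≤-Reasoning

-- Stated for arbitrary graphs so that the conversion check never unfolds concrete
-- homomorphism counts.
≤-val : ∀ {k l m} lam (H₁ : Graph k) (H₂ : Graph l) (G : Graph (suc m)) p →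
  (let instance _ = ℕ.m^n≢0 (suc m) k
                _ = ℕ.m^n≢0 (suc m) l in
   p ≤ lam * (+ hom H₁ (adj G) / (suc m ℕ.^ k)) + ((1ℚ + 1ℚ) - lam) * (+ hom H₂ (compl G) / (suc m ℕ.^ l))) →
  p ≤ val lam H₁ H₂ G
≤-val lam H₁ H₂ G p h = h

K3-C5-bound : ∀ n .{{_ : NonZero n}} (G : Graph n) ε → 0ℚ < ε → 120 ℕ.* ↧ₙ ε ℕ.≤ n →
  let instance n³≢0 = ℕ.m^n≢0 n 3 ; n⁵≢0 = ℕ.m^n≢0 n 5 in
  + 3 / 34 - ε ≤ + 10 / 17 * (+ hom K3 (adj G) / (n ℕ.^ 3)) + ((1ℚ + 1ℚ) - + 10 / 17) * (+ hom C5 (compl G) / (n ℕ.^ 5))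
K3-C5-bound n G = 3/34-ε≤v n (+ hom K3 (adj G)) (+ hom C5 (compl G)) (+ n) refl (density-bound G)

liminf-≥ : LiminfGe K3 C5 (+ 10 / 17) (+ 3 / 34)
liminf-≥ ε 0<ε = 120 ℕ.* ↧ₙ ε , λ m N≤n G →
  ≤-val (+ 10 / 17) K3 C5 G (+ 3 / 34 - ε) (K3-C5-bound (suc m) G ε 0<ε N≤n)

-- Blow-ups

sumFin-++ : ∀ m {n} (f : Fin (m ℕ.+ n) → ℕ) →
            sumFin (m ℕ.+ n) f ≡ sumFin m (f ∘ (_↑ˡ n)) ℕ.+ sumFin n (f ∘ (m ↑ʳ_))
sumFin-++ zero    f = refl
sumFin-++ (suc m) f = trans (cong (ℕ._+_ (f zero)) (sumFin-++ m (f ∘ suc))) (sym (ℕ.+-assoc (f zero) _ _))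

sumFin-const : ∀ n {f : Fin n → ℕ} {x} → (∀ i → f i ≡ x) → sumFin n f ≡ n ℕ.* x
sumFin-const zero    p = refl
sumFin-const (suc n) p = cong₂ ℕ._+_ (p zero) (sumFin-const n (p ∘ suc))

sumFin-mono : ∀ n {f g : Fin n → ℕ} → (∀ i → f i ℕ.≤ g i) → sumFin n f ℕ.≤ sumFin n g
sumFin-mono zero    p = z≤n
sumFin-mono (suc n) p = ℕ.+-mono-≤ (p zero) (sumFin-mono n (p ∘ suc))

quotient-↑ˡ : ∀ {n k} (i : Fin k) → quotient {suc n} k (i ↑ˡ (n ℕ.* k)) ≡ zero
quotient-↑ˡ {n} {k} i rewrite splitAt-↑ˡ k i (n ℕ.* k) = refl

quotient-↑ʳ : ∀ {n k} (i : Fin (n ℕ.* k)) → quotient {suc n} k (k ↑ʳ i) ≡ suc (quotient k i)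
quotient-↑ʳ {n} {k} i rewrite splitAt-↑ʳ k (n ℕ.* k) i = refl

-- Every fibre of `quotient k` has `k` elements. The factor `c` carries the power of `k` already
-- produced by the inner sums of `countMaps`.
sumFin-quotient : ∀ n k c {F : Fin (n ℕ.* k) → ℕ} {f : Fin n → ℕ} →
                  (∀ i → F i ≡ c ℕ.* f (quotient k i)) → sumFin (n ℕ.* k) F ≡ k ℕ.* c ℕ.* sumFin n f
sumFin-quotient zero    k c p = sym (ℕ.*-zeroʳ (k ℕ.* c))
sumFin-quotient (suc n) k c {F} {f} p = trans (sumFin-++ k F)
  (trans (cong₂ ℕ._+_
    (sumFin-const k λ i → trans (p (i ↑ˡ (n ℕ.* k))) (cong (λ j → c ℕ.* f j) (quotient-↑ˡ i)))
    (sumFin-quotient n k c {f = f ∘ suc} λ i → trans (p (k ↑ʳ i)) (cong (λ j → c ℕ.* f j) (quotient-↑ʳ {n} i))))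
  (lem k c (f zero) (sumFin n (f ∘ suc))))
  where
  lem : ∀ k c x y → k ℕ.* (c ℕ.* x) ℕ.+ k ℕ.* c ℕ.* y ≡ k ℕ.* c ℕ.* (x ℕ.+ y)
  lem = ℕ.solve-∀

-- The hypothesis relates all pointwise matching `f` and `g` rather than `f` and its composite with
-- `quotient k`: the maps that `countMaps` builds by prepending a value agree only pointwise, and
-- this form survives the induction.
countMaps-quotient : ∀ {n k} j {Q : (Fin j → Fin (n ℕ.* k)) → Bool} {P : (Fin j → Fin n) → Bool} →
  (∀ f g → (∀ i → quotient k (f i) ≡ g i) → Q f ≡ P g) →
  countMaps j (n ℕ.* k) Q ≡ k ℕ.^ j ℕ.* countMaps j n P
countMaps-quotient zero    p = trans (cong (if_then 1 else 0) (p _ _ λ ())) (sym (ℕ.*-identityˡ _))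
countMaps-quotient {n} {k} (suc j) p =
  sumFin-quotient n k (k ℕ.^ j) λ v → countMaps-quotient j λ f g q → p _ _ λ { zero → refl ; (suc i) → q i }

indicator-mono : ∀ {b c} → (b ≡ true → c ≡ true) → (if b then 1 else 0) ℕ.≤ (if c then 1 else 0)
indicator-mono {false} p = z≤n
indicator-mono {true}  p rewrite p refl = ℕ.≤-refl

countMaps-mono : ∀ {n} k {P Q : (Fin k → Fin n) → Bool} →
  (∀ f → P f ≡ true → Q f ≡ true) → countMaps k n P ℕ.≤ countMaps k n Q
countMaps-mono zero p = indicator-mono (p _)
countMaps-mono {n} (suc k) p = sumFin-mono n λ v → countMaps-mono k λ f → p _

allFin-cong : ∀ n {p q : Fin n → Bool} → (∀ i → p i ≡ q i) → allFin n p ≡ allFin n q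
allFin-cong zero    r = refl
allFin-cong (suc n) r = cong₂ _∧_ (r zero) (allFin-cong n (r ∘ suc))

allFin-mono : ∀ n {p q : Fin n → Bool} → (∀ i → p i ≡ true → q i ≡ true) → allFin n p ≡ true → allFin n q ≡ true
allFin-mono zero    r eq = refl
allFin-mono (suc n) {p} r eq with p zero in e₀ | allFin n (p ∘ suc) in e₁
... | true | true = cong₂ _∧_ (r zero e₀) (allFin-mono n (r ∘ suc) e₁)

inflate : ∀ {n} k → (Fin n → Fin n → Bool) → Fin (n ℕ.* k) → Fin (n ℕ.* k) → Bool
inflate k A x y = A (quotient k x) (quotient k y)

module _ {j : ℕ} (H : Graph j) where
  hom-mono : ∀ {n} {A B : Fin n → Fin n → Bool} → (∀ x y → A x y ≡ true → B x y ≡ true) → hom H A ℕ.≤ hom H B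
  hom-mono {A = A} {B} A⊆B = countMaps-mono j λ f →
    allFin-mono j λ u → allFin-mono j λ v → if-mono (adj H u v) (A⊆B (f u) (f v))
    where
    if-mono : ∀ b {x y} → (x ≡ true → y ≡ true) → (if b then x else true) ≡ true → (if b then y else true) ≡ true
    if-mono true  p = p
    if-mono false p = λ e → e

  hom-inflate : ∀ {n} k (A : Fin n → Fin n → Bool) → hom H (inflate k A) ≡ k ℕ.^ j ℕ.* hom H A
  hom-inflate k A = countMaps-quotient j λ f g p → allFin-cong j λ u → allFin-cong j λ v →
      cong (λ b → if adj H u v then b else true) (cong₂ A (p u) (p v))

p≤q⇒0≤q-p : ∀ {p q} → p ≤ q → 0ℚ ≤ q - p
p≤q⇒0≤q-p {p} {q} p≤q = subst (_≤ q - p) (+-inverseʳ p) (+-monoˡ-≤ (- p) p≤q)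

^-distribʳ-* : ∀ m n o → (m ℕ.* n) ℕ.^ o ≡ m ℕ.^ o ℕ.* n ℕ.^ o
^-distribʳ-* m n zero    = refl
^-distribʳ-* m n (suc o) = trans (cong (ℕ._*_ (m ℕ.* n)) (^-distribʳ-* m n o)) (lem m n (m ℕ.^ o) (n ℕ.^ o))
  where
  lem : ∀ m n x y → m ℕ.* n ℕ.* (x ℕ.* y) ≡ m ℕ.* x ℕ.* (n ℕ.* y)
  lem = ℕ.solve-∀

module _ {j r : ℕ} (H : Graph j) where
  tdens-mono : {A B : Fin (suc r) → Fin (suc r) → Bool} →
    (∀ x y → A x y ≡ true → B x y ≡ true) → tdens H A ≤ tdens H B
  tdens-mono {A} {B} A⊆B = /-mono-≤ (+ hom H A) (suc r ℕ.^ j) (+ hom H B) (suc r ℕ.^ j)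
    (ℤ.*-monoʳ-≤-nonNeg (+ (suc r ℕ.^ j)) (ℤ.+≤+ (hom-mono H A⊆B)))
    where instance _ = ℕ.m^n≢0 (suc r) j

  -- The number of homomorphisms and the number of all maps both gain the factor (k+1)^j.
  tdens-inflate : ∀ k (A : Fin (suc r) → Fin (suc r) → Bool) → tdens H (inflate (suc k) A) ≡ tdens H A
  tdens-inflate k A = /-cross (+ hom H (inflate (suc k) A)) ((suc r ℕ.* suc k) ℕ.^ j) (+ hom H A) (suc r ℕ.^ j)
    (trans (sym (ℤ.pos-* (hom H (inflate (suc k) A)) (suc r ℕ.^ j)))
    (trans (cong +_ (cross (suc r) (suc k) A))
      (ℤ.pos-* (hom H A) ((suc r ℕ.* suc k) ℕ.^ j))))
    where
    instance _ = ℕ.m^n≢0 (suc r) j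
             _ = ℕ.m^n≢0 (suc r ℕ.* suc k) j
    lem : ∀ x y z → x ℕ.* y ℕ.* z ≡ y ℕ.* (z ℕ.* x)
    lem = ℕ.solve-∀
    cross : ∀ n k (A : Fin n → Fin n → Bool) →
            hom H (inflate k A) ℕ.* n ℕ.^ j ≡ hom H A ℕ.* (n ℕ.* k) ℕ.^ j
    cross n k A rewrite hom-inflate H k A | ^-distribʳ-* n k j = lem (k ℕ.^ j) (hom H A) (n ℕ.^ j)

blowUp : ∀ {n} → Graph n → ∀ k → Graph (n ℕ.* k)
blowUp G k = record
  { adj    = inflate k (adj G)
  ; sym    = λ x y → Graph.sym G (quotient k x) (quotient k y)
  ; irrefl = λ x → irrefl G (quotient k x)
  }

compl⊆coadj : ∀ {n} (G : Graph n) x y → compl G x y ≡ true → coadj G x y ≡ true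
compl⊆coadj G x y p with not (adj G x y)
... | true = refl

module _ {k l r : ℕ} (lam : ℚ) (lam≤2 : lam ≤ two) (H₁ : Graph k) (H₂ : Graph l) (G : Graph (suc r)) where
  -- With its loops restored, the complement of the blow-up is the inflation of `coadj G`, whose
  -- density is independent of the factor. Restoring loops can only raise the C5 density, and its
  -- weight 2 - λ is nonnegative, so the limit value bounds every single blow-up.
  val-blowUp : ∀ s → val lam H₁ H₂ (blowUp G (suc s)) ≤ lam * tdens H₁ (adj G) + (two - lam) * tdens H₂ (coadj G)
  val-blowUp s = +-mono-≤
    (≤-reflexive (cong (lam *_) (tdens-inflate H₁ s (adj G))))
    (*-monoˡ-≤-nonNeg (two - lam) {{nonNegative (p≤q⇒0≤q-p lam≤2)}}
      (≤-trans (tdens-mono H₂ (compl⊆coadj (blowUp G (suc s))))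
               (≤-reflexive (tdens-inflate H₂ s (coadj G)))))

  liminf-≤-blowUp : ∀ {q} → lam * tdens H₁ (adj G) + (two - lam) * tdens H₂ (coadj G) ≤ q →
                    LiminfLe H₁ H₂ lam q
  liminf-≤-blowUp {q} p ε 0<ε N =
    -- The successor of this number is `suc r * suc N` by computation, the order of the blow-up by
    -- `suc N`; using `suc N` keeps the blow-up nonempty when `N` is 0.
    N ℕ.+ r ℕ.* suc N , ℕ.≤-trans (ℕ.m≤m+n N (r ℕ.* suc N)) (ℕ.n≤1+n _) , blowUp G (suc N) ,
    ≤-trans (val-blowUp N) (≤-trans p (≤-trans (≤-reflexive (sym (+-identityʳ q))) (+-monoʳ-≤ q (<⇒≤ 0<ε))))

-- The two extremal constructions.

K2 : Graph 2
K2 = record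
  { adj    = λ { zero zero → false ; zero (suc _) → true ; (suc _) zero → true ; (suc _) (suc _) → false }
  ; sym    = λ { zero zero → refl ; zero (suc _) → refl ; (suc _) zero → refl ; (suc _) (suc _) → refl }
  ; irrefl = λ { zero → refl ; (suc _) → refl }
  }

-- Its complement with loops is the 6-cycle with loops, whose adjacency matrix has the
-- eigenvalues 3, 2, 2, 0, 0, −1; this gives 3⁵ + 2 · 2⁵ − 1 = 306 closed 5-walks.
prism : Graph 6
prism = record
  { adj    = λ i j → far ℕ.∣ toℕ i - toℕ j ∣
  ; sym    = λ i j → cong far (ℕ.∣-∣-comm (toℕ i) (toℕ j))
  ; irrefl = λ i → cong far (ℕ.∣n-n∣≡0 (toℕ i))
  }
  where
  far : ℕ → Bool
  far d = (2 ℕ.≤ᵇ d) ∧ (d ℕ.≤ᵇ 4)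

affine-mono : ∀ c {l m x y} → l ≤ m → y ≤ x → l * x + (c - l) * y ≤ m * x + (c - m) * y
affine-mono c {l} {m} {x} {y} l≤m y≤x = begin
  l * x + (c - l) * y    ≡⟨ lem c l x y ⟩
  c * y + l * (x - y)    ≤⟨ +-monoʳ-≤ (c * y) (*-monoʳ-≤-nonNeg (x - y) {{nonNegative (p≤q⇒0≤q-p y≤x)}} l≤m) ⟩
  c * y + m * (x - y)    ≡⟨ lem c m x y ⟨
  m * x + (c - m) * y    ∎
  where
  open ≤-Reasoning
  open +-*-Solver
  lem : ∀ c l x y → l * x + (c - l) * y ≡ c * y + l * (x - y)
  lem = solve 4 (λ c l x y → l :* x :+ (c :- l) :* y := c :* y :+ l :* (x :- y)) refl

affine-antimono : ∀ c {l m x y} → m ≤ l → x ≤ y → l * x + (c - l) * y ≤ m * x + (c - m) * y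
affine-antimono c {l} {m} {x} {y} m≤l x≤y = begin
  l * x + (c - l) * y          ≡⟨ lem c l x y ⟩
  c * x + (c - l) * (y - x)    ≤⟨ +-monoʳ-≤ (c * x) (*-monoʳ-≤-nonNeg (y - x) {{nonNegative (p≤q⇒0≤q-p x≤y)}}
                                   (+-monoʳ-≤ c (neg-antimono-≤ m≤l))) ⟩
  c * x + (c - m) * (y - x)    ≡⟨ lem c m x y ⟨
  m * x + (c - m) * y          ∎
  where
  open ≤-Reasoning
  open +-*-Solver
  lem : ∀ c l x y → l * x + (c - l) * y ≡ c * x + (c - l) * (y - x)
  lem = solve 4 (λ c l x y → l :* x :+ (c :- l) :* y := c :* x :+ (c :- l) :* (y :- x)) refl

tdens-K3-prism : tdens K3 (adj prism) ≡ + 1 / 18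
-- The prism has two triangles, each the image of 6 of the 6^3 = 216 maps.
tdens-K3-prism = /-cross (+ 12) 216 (+ 1) 18 refl

tdens-C5-prism : tdens C5 (coadj prism) ≡ + 17 / 432
tdens-C5-prism = /-cross (+ 306) 7776 (+ 17) 432 refl

tdens-K3-K2 : tdens K3 (adj K2) ≡ 0ℚ
tdens-K3-K2 = refl

-- `coadj K2` consists of two isolated loops, so only the two constant maps among 2^5 are
-- homomorphisms.
tdens-C5-K2 : tdens C5 (coadj K2) ≡ + 1 / 16
tdens-C5-K2 = /-cross (+ 2) 32 (+ 1) 16 refl

prism-bound : ∀ {lam} → lam ≤ + 10 / 17 →
  lam * tdens K3 (adj prism) + (two - lam) * tdens C5 (coadj prism) ≤ + 3 / 34
prism-bound {lam} p = subst₂ (λ x y → lam * x + (two - lam) * y ≤ + 3 / 34)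
  (sym tdens-K3-prism) (sym tdens-C5-prism)
  -- This line rises with λ, and its value at 10/17 is 10/306 + 17/306 = 27/306, which evaluates to
  -- 3/34.
  (affine-mono two p (toWitness {a? = + 17 / 432 ≤? + 1 / 18} tt))

K2-bound : ∀ {lam} → + 10 / 17 ≤ lam →
  lam * tdens K3 (adj K2) + (two - lam) * tdens C5 (coadj K2) ≤ + 3 / 34
K2-bound {lam} p = subst₂ (λ x y → lam * x + (two - lam) * y ≤ + 3 / 34)
  (sym tdens-K3-K2) (sym tdens-C5-K2)
  -- This line falls with λ, and its value at 10/17 is 24/17 * 1/16, which evaluates to 3/34.
  (affine-antimono two p (toWitness {a? = 0ℚ ≤? + 1 / 16} tt))

-- The minimum of a rising and a falling line is largest where they cross, here at λ = 10/17, so no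
-- λ can give more than the crossing value.
liminf-≤ : ∀ lam → lam ≤ two → LiminfLe K3 C5 lam (+ 3 / 34)
liminf-≤ lam lam≤2 =
  [ (λ p → liminf-≤-blowUp lam lam≤2 K3 C5 prism (prism-bound p))
  , (λ p → liminf-≤-blowUp lam lam≤2 K3 C5 K2 (K2-bound p))
  ]′ (≤-total lam (+ 10 / 17))

theorem1p10 : LiminfGe K3 C5 ((+ 10) / 17) ((+ 3) / 34)
    × LiminfLe K3 C5 ((+ 10) / 17) ((+ 3) / 34)
    × (∀ (lam : ℚ) → 0ℚ ≤ lam → lam ≤ two → LiminfLe K3 C5 lam ((+ 3) / 34))
theorem1p10 =
  liminf-≥
  , liminf-≤ (+ 10 / 17) (toWitness {a? = + 10 / 17 ≤? two} tt)
  , λ lam _ lam≤2 → liminf-≤ lam lam≤2
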